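{- Every abstract polytope can be constructed as a coset geometry. Precisely: let $\mathcal{P}$ be an abstract $n$-polytope ($n\ge 1$), let $\Gamma=\Gamma(\mathcal{P})$ be its automorphism group and let $X=\mathcal{T}(\mathcal{P})$ be its symmetry type graph. Then there is a voltage assignment $\xi:\Pi(X)\to\Gamma$ such that the coset poset $\mathcal{P}(X,\xi)$ (defined in the context, for any choice of the base vertices and of the paths $W_i^y$ used in its definition) is isomorphic to $\mathcal{P}$ as a partially ordered set.
   Context: **Polytopes.** A poset is flagged if it has a least and a greatest element and all its maximal chains (flags) have the same finite cardinality, say $n+2$; it then has an order-preserving rank function onto $\{ -1,0,\dots,n\}$. Two flags are $i$-adjacent if they differ exactly in their element of rank $i$. An (abstract) $n$-polytope is a flagged poset with rank function onto $\{ -1,\dots,n\}$ such that (diamond condition) for each flag $\Phi$ and each $i\in\{0,\dots,n-1\}$ there is a unique flag $\Phi^i$ that is $i$-adjacent to $\Phi$; and (strong flag connectedness) any two flags $\Phi,\Psi$ are joined by a sequence of flags, consecutive ones adjacent, all containing $\Phi\cap\Psi$. The flag graph $\mathcal{G}(\mathcal{P})$ has the flags as vertices, with an edge of colour $i$ joining each pair of $i$-adjacent flags. **Graphs.** Graphs may have parallel edges and semi-edges. Every edge consists of darts; a dart $d$ has an initial vertex, a terminal vertex and an inverse dart $d^{ -1}$; an edge joining two different vertices (a link) consists of two mutually inverse darts, and a semi-edge consists of a single dart $d=d^{ -1}$ with both ends at the same vertex. An $n$-premaniplex is a connected graph with edges coloured by $\{0,\dots,n-1\}$, all of whose edges are links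 or semi-edges, such that each vertex is incident to exactly one edge of each colour, and such that if $|i-j|>1$ every path of length $4$ alternating between colours $i$ and $j$ is closed. **Symmetry type graph.** For a polytope $\mathcal{P}$ and $G\le\Gamma(\mathcal{P})$, the symmetry type graph $\mathcal{T}(\mathcal{P},G)$ has the $G$-orbits of flags as vertices; for each flag $\Phi$ and colour $i$ there is an edge of colour $i$ joining the orbit of $\Phi$ to that of $\Phi^i$ (a semi-edge if these orbits coincide), so that each vertex has exactly one edge of each colour. $\mathcal{T}(\mathcal{P})=\mathcal{T}(\mathcal{P},\Gamma(\mathcal{P}))$. It is an $n$-premaniplex. **Voltages.** A voltage assignment $\xi:\Pi(X)\to\Gamma$ is a groupoid antimorphism from the fundamental groupoid of $X$; equivalently, it assigns to each dart $d$ an element $\xi(d)\in\Gamma$ with $\xi(d^{ -1})=\xi(d)^{ -1}$ and is extended to paths by $\xi(d_1d_2\cdots d_k)=\xi(d_k)\cdots\xi(d_2)\xi(d_1)$ (empty paths have trivial voltage). For a vertex $x$ and a set of colours $I$, $\xi(\Pi_I^x(X))$ is the subgroup of $\Gamma$ of voltages of closed paths based at $x$ using only darts with colours in $I$. Write $\overline{i}=\{0,\dots,n-1\}\setminus\{i\}$; $X_{\overline i}$ is the graph obtained from $X$ by deleting the edges of colour $i$, and $X_{\overline i}(y)$ is its connected component containing $y$. **The coset poset $\mathcal{P}(X,\xi)$.** Choose for every connected subgraph $C$ of $X$ a base vertex $f(C)\in C$. The elements of rank $i\in\{0,\dots,n-1\}$ of $\mathcal{P}(X,\xi)$ are the right cosets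 $\xi(\Pi^x_{\overline i}(X))\gamma$, $\gamma\in\Gamma$, where $x=f(C)$ and $C$ runs over the connected components of $X_{\overline i}$; they are regarded as formal copies, i.e. as triples consisting of $i$, $C$ and the coset, so that elements with different $i$ or different $C$ are different. For each vertex $y$ of $X$ and each $i$, fix a path $W^y_i$ inside $X_{\overline i}(y)$ from $f(X_{\overline i}(y))$ to $y$, and set $\alpha_i^y=\xi(W_i^y)$. For $i<j$, components $C$ of $X_{\overline i}$ and $C'$ of $X_{\overline j}$ with base vertices $x=f(C)$, $x'=f(C')$, and $\gamma,\gamma'\in\Gamma$, put $\xi(\Pi^x_{\overline i}(X))\gamma<\xi(\Pi^{x'}_{\overline j}(X))\gamma'$ if and only if $\alpha_i^y\,\xi(\Pi^x_{\overline i}(X))\gamma\cap\alpha_j^y\,\xi(\Pi^{x'}_{\overline j}(X))\gamma'\neq\emptyset$ for some vertex $y\in C\cap C'$. A least element (rank $-1$) and a greatest element (rank $n$) are adjoined. -}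

module Defs where

open import Level using (Level; _⊔_; suc; 0ℓ)
open import Data.Fin.Base as Fin using (Fin; toℕ; inject₁; punchOut)
import Data.Fin.Properties as Fin
open import Data.List.Base using (List; []; _∷_)
open import Data.List.Relation.Binary.Pointwise.Base using (Pointwise)
open import Data.Nat.Base as ℕ using (ℕ; z≤n)
import Data.Nat.Properties as ℕ
open import Data.Product.Base using (Σ; Σ-syntax; ∃; ∃-syntax; _×_; _,_; proj₁; proj₂)
open import Data.Product.Relation.Binary.Pointwise.NonDependent using (×-setoid)
open import Data.Sum.Base as Sum using (_⊎_; inj₁; inj₂)
open import Function.Base using (_∘_; id)
open import Function.Bundles using (_⇔_; mk⇔; Equivalence; Bijection)
open import Function.Definitions using (Injective)
open import Relation.Binary.Bundles using (Setoid; Poset)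
open import Relation.Binary.Core using (Rel)
open import Relation.Binary.Definitions using (Minimum; Maximum; _Respects_)
open import Relation.Binary.Morphism.Structures using (IsOrderIsomorphism)
import Relation.Binary.Morphism.Construct.Composition as Composition
import Relation.Binary.Morphism.Construct.Identity as Identity
import Relation.Binary.Construct.Add.Extrema.Equality as AddExtremaEquality
import Relation.Binary.Construct.Add.Extrema.NonStrict as AddExtremaNonStrict
import Relation.Binary.Construct.On as On
import Relation.Binary.Construct.StrictToNonStrict as StrictToNonStrict
import Relation.Binary.Properties.Poset as PosetProperties
open import Relation.Binary.PropositionalEquality as ≡ using (_≡_; _≢_)
open import Relation.Nullary using (¬_; yes; no; contradiction)
open import Relation.Nullary.Construct.Add.Extrema using (_±)
open import Relation.Unary using (Pred; _∈_; _⊆_; _≐_; _≬_; _∩_)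
open import Algebra.Bundles using (Group)

-- The axiom of choice, in the form: every equivalence relation admits a
-- system of representatives.  A voltage assignment on a graph whose vertices
-- are flag orbits depends on choosing a base flag in every orbit.

Choice : ∀ a ℓ → Set (suc (a ⊔ ℓ))
Choice a ℓ = (S : Setoid a ℓ) → let open Setoid S in
  Σ[ rep ∈ (Carrier → Carrier) ]
    (∀ x → rep x ≈ x) × (∀ {x y} → x ≈ y → rep x ≡ rep y)

------------------------------------------------------------------------
-- Polytopes

module Chains {c ℓ₁ ℓ₂} (P : Poset c ℓ₁ ℓ₂) where
  open Poset P

  record IsChain (C : Pred Carrier (c ⊔ ℓ₁ ⊔ ℓ₂)) : Set (c ⊔ ℓ₁ ⊔ ℓ₂) where
    field
      resp       : C Respects _≈_
      comparable : ∀ {x y} → x ∈ C → y ∈ C → x ≤ y ⊎ y ≤ x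

  record Flag : Set (suc (c ⊔ ℓ₁ ⊔ ℓ₂)) where
    field
      ⟨_⟩     : Pred Carrier (c ⊔ ℓ₁ ⊔ ℓ₂)
      isChain : IsChain ⟨_⟩
      maximal : ∀ {D} → IsChain D → ⟨_⟩ ⊆ D → D ⊆ ⟨_⟩

    open IsChain isChain public

  open Flag public using (⟨_⟩)

  elements : Flag → Setoid (c ⊔ ℓ₁ ⊔ ℓ₂) ℓ₁
  elements Φ = On.setoid {B = ∃ ⟨ Φ ⟩} Eq.setoid proj₁

-- Ranks are shifted by one: rank r ∈ {-1, 0, …, n} is represented by the
-- element r + 1 of Fin (2 + n).  The colour i ∈ {0, …, n - 1} is the rank
-- properRank i.

properRank : ∀ {n} → Fin n → Fin (2 ℕ.+ n)
properRank i = Fin.suc (inject₁ i)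

-- The rank function is uniquely determined: being strictly monotone, it
-- restricts to a bijection between every flag and {-1, 0, …, n}.

record FlaggedPoset (n : ℕ) c ℓ₁ ℓ₂ : Set (suc (c ⊔ ℓ₁ ⊔ ℓ₂)) where
  field
    poset : Poset c ℓ₁ ℓ₂

  open Poset poset public
  open PosetProperties poset public using (_<_)
  open Chains poset public

  field
    least     : ∃ (Minimum _≤_)
    greatest  : ∃ (Maximum _≤_)
    flagSize  : ∀ Φ → Bijection (≡.setoid (Fin (2 ℕ.+ n))) (elements Φ)
    rank      : Carrier → Fin (2 ℕ.+ n)
    rank-cong : ∀ {x y} → x ≈ y → rank x ≡ rank y
    rank-mono : ∀ {x y} → x < y → rank x Fin.< rank y
    rank-onto : ∀ r → ∃[ x ] rank x ≡ r

  record Adjacent (i : Fin n) (Φ Ψ : Flag) : Set (c ⊔ ℓ₁ ⊔ ℓ₂) where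
    field
      fwd : ∀ {x} → x ∈ ⟨ Φ ⟩ → x ∈ ⟨ Ψ ⟩ ⇔ rank x ≢ properRank i
      bwd : ∀ {x} → x ∈ ⟨ Ψ ⟩ → x ∈ ⟨ Φ ⟩ ⇔ rank x ≢ properRank i

  -- Joined S Φ Ψ: a sequence of successively adjacent flags from Φ to Ψ,
  -- all containing S.

  data Joined (S : Pred Carrier (c ⊔ ℓ₁ ⊔ ℓ₂)) : Rel Flag (suc (c ⊔ ℓ₁ ⊔ ℓ₂)) where
    stop : ∀ {Φ Ψ} → S ⊆ ⟨ Φ ⟩ → ⟨ Φ ⟩ ≐ ⟨ Ψ ⟩ → Joined S Φ Ψ
    step : ∀ {Φ Θ Ψ} i → S ⊆ ⟨ Φ ⟩ → Adjacent i Φ Θ → Joined S Θ Ψ → Joined S Φ Ψ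

record Polytope (n : ℕ) c ℓ₁ ℓ₂ : Set (suc (c ⊔ ℓ₁ ⊔ ℓ₂)) where
  field
    flaggedPoset : FlaggedPoset n c ℓ₁ ℓ₂

  open FlaggedPoset flaggedPoset public

  field
    diamond   : ∀ Φ i → Σ[ Ψ ∈ Flag ] Adjacent i Φ Ψ ×
                          (∀ {Θ} → Adjacent i Φ Θ → ⟨ Θ ⟩ ≐ ⟨ Ψ ⟩)
    connected : ∀ Φ Ψ → Joined (⟨ Φ ⟩ ∩ ⟨ Ψ ⟩) Φ Ψ

  infixl 8 _^_
  _^_ : Flag → Fin n → Flag
  Φ ^ i = proj₁ (diamond Φ i)

------------------------------------------------------------------------
-- Automorphisms

module _ {c ℓ₁ ℓ₂} (P : Poset c ℓ₁ ℓ₂) where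
  open Poset P

  record Automorphism : Set (c ⊔ ℓ₁ ⊔ ℓ₂) where
    field
      ⟦_⟧                : Carrier → Carrier
      isOrderIsomorphism : IsOrderIsomorphism _≈_ _≈_ _≤_ _≤_ ⟦_⟧

    open IsOrderIsomorphism isOrderIsomorphism public

    from : Carrier → Carrier
    from y = proj₁ (surjective y)

    to∘from : ∀ y → ⟦ from y ⟧ ≈ y
    to∘from y = proj₂ (surjective y) Eq.refl

    from∘to : ∀ x → from ⟦ x ⟧ ≈ x
    from∘to x = injective (to∘from ⟦ x ⟧)

  open Automorphism using (⟦_⟧)

  private
    inverse : Automorphism → Automorphism
    inverse γ = record
      { ⟦_⟧ = G.from
      ; isOrderIsomorphism = record
        { isOrderMonomorphism = record
          { isOrderHomomorphism = record
            { cong = λ x≈y → G.injective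
                (Eq.trans (G.to∘from _) (Eq.trans x≈y (Eq.sym (G.to∘from _))))
            ; mono = λ x≤y → G.cancel
                (≤-respˡ-≈ (Eq.sym (G.to∘from _)) (≤-respʳ-≈ (Eq.sym (G.to∘from _)) x≤y))
            }
          ; injective = λ fx≈fy →
              Eq.trans (Eq.sym (G.to∘from _)) (Eq.trans (G.cong fx≈fy) (G.to∘from _))
          ; cancel = λ fx≤fy →
              ≤-respˡ-≈ (G.to∘from _) (≤-respʳ-≈ (G.to∘from _) (G.mono fx≤fy))
          }
        ; surjective = λ x → ⟦ γ ⟧ x , λ z≈γx →
            G.injective (Eq.trans (G.to∘from _) z≈γx)
        }
      }
      where module G = Automorphism γ

  -- Automorphisms act on the right: γ ∙ δ is γ followed by δ.

  Γ : Group (c ⊔ ℓ₁ ⊔ ℓ₂) (c ⊔ ℓ₁)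
  Γ = record
    { Carrier = Automorphism
    ; _≈_     = λ γ δ → ∀ x → ⟦ γ ⟧ x ≈ ⟦ δ ⟧ x
    ; _∙_     = λ γ δ → record
      { ⟦_⟧ = ⟦ δ ⟧ ∘ ⟦ γ ⟧
      ; isOrderIsomorphism = Composition.isOrderIsomorphism Eq.trans
          (Automorphism.isOrderIsomorphism γ) (Automorphism.isOrderIsomorphism δ)
      }
    ; ε       = record
      { ⟦_⟧ = id
      ; isOrderIsomorphism = Identity.isOrderIsomorphism _≈_ _≤_ Eq.refl
      }
    ; _⁻¹     = inverse
    ; isGroup = record
      { isMonoid = record
        { isSemigroup = record
          { isMagma = record
            { isEquivalence = record
              { refl  = λ _ → Eq.refl
              ; sym   = λ γ≈δ x → Eq.sym (γ≈δ x)
              ; trans = λ γ≈δ δ≈η x → Eq.trans (γ≈δ x) (δ≈η x)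
              }
            ; ∙-cong = λ {_} {_} {_} {δ₁} γ≈γ₁ δ≈δ₁ x →
                Eq.trans (δ≈δ₁ _) (Automorphism.cong δ₁ (γ≈γ₁ x))
            }
          ; assoc = λ _ _ _ _ → Eq.refl
          }
        ; identity = (λ _ _ → Eq.refl) , (λ _ _ → Eq.refl)
        }
      ; inverse = Automorphism.to∘from , Automorphism.from∘to
      ; ⁻¹-cong = λ {γ} {δ} γ≈δ x → Automorphism.injective γ
          (Eq.trans (Automorphism.to∘from γ x)
            (Eq.trans (Eq.sym (Automorphism.to∘from δ x))
              (Eq.sym (γ≈δ (Automorphism.from δ x)))))
      }
    }

------------------------------------------------------------------------
-- Coloured graphs, paths and voltages

-- Vertices and darts are setoids, so that quotients such as the set of
-- flag orbits can be used.  An edge is a pair {d , inv d}; no-loops says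
-- that every edge is a link or a semi-edge.

record ColouredGraph (n : ℕ) v ℓv d ℓd : Set (suc (v ⊔ ℓv ⊔ d ⊔ ℓd)) where
  field
    vertices : Setoid v ℓv
    darts    : Setoid d ℓd

  module V = Setoid vertices
  module D = Setoid darts

  field
    init term   : D.Carrier → V.Carrier
    inv         : D.Carrier → D.Carrier
    colour      : D.Carrier → Fin n
    init-cong   : ∀ {d e} → d D.≈ e → init d V.≈ init e
    term-cong   : ∀ {d e} → d D.≈ e → term d V.≈ term e
    inv-cong    : ∀ {d e} → d D.≈ e → inv d D.≈ inv e
    colour-cong : ∀ {d e} → d D.≈ e → colour d ≡ colour e
    inv-inv     : ∀ d → inv (inv d) D.≈ d
    init-inv    : ∀ d → init (inv d) V.≈ term d
    term-inv    : ∀ d → term (inv d) V.≈ init d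
    colour-inv  : ∀ d → colour (inv d) ≡ colour d
    no-loops    : ∀ d → init d V.≈ term d → inv d D.≈ d
    unique-dart : ∀ x i → Σ[ d ∈ D.Carrier ] init d V.≈ x × colour d ≡ i ×
                    (∀ {e} → init e V.≈ x → colour e ≡ i → e D.≈ d)

  data Path (I : Pred (Fin n) 0ℓ) (x y : V.Carrier) : Set (v ⊔ ℓv ⊔ d) where
    empty : x V.≈ y → Path I x y
    cons  : ∀ e → colour e ∈ I → x V.≈ init e → Path I (term e) y → Path I x y

  dartsOf : ∀ {I x y} → Path I x y → List D.Carrier
  dartsOf (empty _)      = []
  dartsOf (cons e _ _ p) = e ∷ dartsOf p

  allBut : Fin n → Pred (Fin n) 0ℓ
  allBut i j = j ≢ i

module _ {n v ℓv d ℓd} (X : ColouredGraph n v ℓv d ℓd) where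
  open ColouredGraph X

  record Voltage {g ℓg} (G : Group g ℓg) : Set (d ⊔ ℓd ⊔ g ⊔ ℓg) where
    open Group G
    field
      ξ      : D.Carrier → Carrier
      ξ-cong : ∀ {d e} → d D.≈ e → ξ d ≈ ξ e
      ξ-inv  : ∀ d → ξ (inv d) ≈ ξ d ⁻¹

    ξ* : ∀ {I x y} → Path I x y → Carrier
    ξ* (empty _)      = ε
    ξ* (cons e _ _ p) = ξ* p ∙ ξ e

  -- The choices in the construction of the coset poset.  A connected
  -- component of the graph without colour i is given by any of its
  -- vertices y, and two vertices give the same component iff they are
  -- joined by a path in the colours allBut i.

  record BaseChoice : Set (v ⊔ ℓv ⊔ d ⊔ ℓd) where
    field
      base      : Fin n → V.Carrier → V.Carrier
      base-in   : ∀ i y → Path (allBut i) y (base i y)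
      base-cong : ∀ i {y z} → Path (allBut i) y z → base i y V.≈ base i z
      W         : ∀ i y → Path (allBut i) (base i y) y
      W-cong    : ∀ i {y z} → y V.≈ z →
                  Pointwise D._≈_ (dartsOf (W i y)) (dartsOf (W i z))

  module CosetPoset {g ℓg} (G : Group g ℓg) (voltage : Voltage G) (choice : BaseChoice) where
    open Group G
    open Voltage voltage
    open BaseChoice choice

    ℓc : Level
    ℓc = v ⊔ ℓv ⊔ d ⊔ g ⊔ ℓg

    -- The subgroup ξ(Π_I^x(X)).
    closedVoltages : Pred (Fin n) 0ℓ → V.Carrier → Pred Carrier (v ⊔ ℓv ⊔ d ⊔ ℓg)
    closedVoltages I x γ = Σ[ p ∈ Path I x x ] γ ≈ ξ* p

    infixl 7 _▹_
    _▹_ : ∀ {ℓ} → Pred Carrier ℓ → Carrier → Pred Carrier (g ⊔ ℓg ⊔ ℓ)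
    (H ▹ γ) δ = ∃[ η ] η ∈ H × δ ≈ η ∙ γ

    infixr 6 _◃_
    _◃_ : ∀ {ℓ} → Carrier → Pred Carrier ℓ → Pred Carrier (g ⊔ ℓg ⊔ ℓ)
    (γ ◃ S) δ = ∃[ η ] η ∈ S × δ ≈ γ ∙ η

    α : Fin n → V.Carrier → Carrier
    α i y = ξ* (W i y)

    record Face : Set (v ⊔ g) where
      constructor face
      field
        index     : Fin n
        component : V.Carrier
        rep       : Carrier

      coset : Pred Carrier ℓc
      coset = closedVoltages (allBut index) (base index component) ▹ rep

    open Face

    infix 4 _≈F_ _<F_

    _≈F_ : Rel Face ℓc
    A ≈F B = index A ≡ index B
           × Path (allBut (index A)) (component A) (component B)
           × coset A ≐ coset B

    _<F_ : Rel Face ℓc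
    A <F B = index A Fin.< index B
           × ∃[ y ] Path (allBut (index A)) (component A) y
                  × Path (allBut (index B)) (component B) y
                  × (α (index A) y ◃ coset A) ≬ (α (index B) y ◃ coset B)

    open StrictToNonStrict _≈F_ _<F_ using () renaming (_≤_ to _≤F_) public
    open AddExtremaEquality _≈F_ using (_≈±_) public
    open AddExtremaNonStrict _≤F_ using (_≤±_) public

    -- For an arbitrary voltage _≤±_ need not be a partial order; an order
    -- isomorphism onto a poset entails that it is.

    _IsIsomorphicTo_ : ∀ {p ℓ₁ ℓ₂} → Poset p ℓ₁ ℓ₂ → Set (ℓc ⊔ p ⊔ ℓ₁ ⊔ ℓ₂)
    _IsIsomorphicTo_ P = Σ[ f ∈ (Face ± → P.Carrier) ]
        IsOrderIsomorphism _≈±_ P._≈_ _≤±_ P._≤_ f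
      where module P = Poset P

------------------------------------------------------------------------
-- The symmetry type graph

module SymmetryTypeGraph {n c ℓ₁ ℓ₂} (𝒫 : Polytope n c ℓ₁ ℓ₂) where
  open Polytope 𝒫

  G : Group (c ⊔ ℓ₁ ⊔ ℓ₂) (c ⊔ ℓ₁)
  G = Γ poset

  module G = Group G

  record IsRank (r : Carrier → Fin (2 ℕ.+ n)) : Set (c ⊔ ℓ₁ ⊔ ℓ₂) where
    field
      r-cong : ∀ {x y} → x ≈ y → r x ≡ r y
      r-mono : ∀ {x y} → x < y → r x Fin.< r y

  open IsRank

  module RankUnique (Φ : Flag) where
    open Bijection (flagSize Φ) using (to; injective; surjective)

    e : Fin (2 ℕ.+ n) → Carrier
    e k = proj₁ (to k)

    compare : ∀ k l → k ≢ l → e k < e l ⊎ e l < e k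
    compare k l k≢l = Sum.map
      (_, λ eq → k≢l (injective eq)) (_, λ eq → k≢l (≡.sym (injective eq)))
      (Flag.comparable Φ (proj₂ (to k)) (proj₂ (to l)))

    module _ {r} (R : IsRank r) where
      r∘e-injective : ∀ {k l} → r (e k) ≡ r (e l) → k ≡ l
      r∘e-injective {k} {l} eq with k Fin.≟ l
      ... | yes k≡l = k≡l
      ... | no  k≢l with compare k l k≢l
      ...   | inj₁ lt = contradiction (r-mono R lt) (Fin.<-irrefl eq)
      ...   | inj₂ lt = contradiction (r-mono R lt) (Fin.<-irrefl (≡.sym eq))

      r∘e-surjective : ∀ j → ∃[ k ] r (e k) ≡ j
      r∘e-surjective j with Fin.any? (λ k → r (e k) Fin.≟ j)
      ... | yes hit = hit
      ... | no miss = contradiction (Fin.injective⇒≤ f-injective) ℕ.1+n≰n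
        where
        j≢ : ∀ k → j ≢ r (e k)
        j≢ k eq = miss (k , ≡.sym eq)

        f : Fin (2 ℕ.+ n) → Fin (1 ℕ.+ n)
        f k = punchOut (j≢ k)

        f-injective : Injective _≡_ _≡_ f
        f-injective {k} {l} eq =
          r∘e-injective (Fin.punchOut-injective (j≢ k) (j≢ l) eq)

    r≤s : ∀ {r s} → IsRank r → IsRank s → ∀ m k → toℕ (r (e k)) ≡ m → m ℕ.≤ toℕ (s (e k))
    r≤s         R S ℕ.zero    k eq = z≤n
    r≤s {r} {s} R S (ℕ.suc m) k eq
      with m<N ← ℕ.<-trans (≡.subst (m ℕ.<_) (≡.sym eq) (ℕ.n<1+n m)) (Fin.toℕ<n (r (e k)))
      with l , eq₁ ← r∘e-surjective R (Fin.fromℕ< m<N)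
      with rl≡m ← ≡.trans (≡.cong toℕ eq₁) (Fin.toℕ-fromℕ< m<N)
      with compare l k (λ { ≡.refl → ℕ.1+n≢n (≡.trans (≡.sym eq) rl≡m) })
    ... | inj₁ l<k = ℕ.≤-<-trans (r≤s R S m l rl≡m) (r-mono S l<k)
    ... | inj₂ k<l = contradiction (r-mono R k<l)
            (ℕ.≤⇒≯ (≡.subst₂ ℕ._≤_ (≡.sym rl≡m) (≡.sym eq) (ℕ.n≤1+n m)))

    unique : ∀ {r s} → IsRank r → IsRank s → ∀ {x} → x ∈ ⟨ Φ ⟩ → r x ≡ s x
    unique {r} {s} R S {x} x∈Φ = ≡.trans (r-cong R x≈ek) (≡.trans
        (Fin.toℕ-injective (ℕ.≤-antisym (r≤s R S _ k ≡.refl) (r≤s S R _ k ≡.refl)))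
        (r-cong S (Eq.sym x≈ek)))
      where
      k : Fin (2 ℕ.+ n)
      k = proj₁ (surjective (x , x∈Φ))

      x≈ek : x ≈ e k
      x≈ek = Eq.sym (proj₂ (surjective (x , x∈Φ)) ≡.refl)

  rank-aut : ∀ (γ : G.Carrier) Φ {x} → x ∈ ⟨ Φ ⟩ → rank (Automorphism.⟦ γ ⟧ x) ≡ rank x
  rank-aut γ Φ x∈Φ = RankUnique.unique Φ
    (record { r-cong = rank-cong ∘ A.cong
            ; r-mono = λ { (x≤y , x≉y) → rank-mono (A.mono x≤y , x≉y ∘ A.injective) } })
    (record { r-cong = rank-cong ; r-mono = rank-mono }) x∈Φ
    where module A = Automorphism γ

  -- The image of a flag under an automorphism.

  infixl 7 _·_
  _·_ : Flag → G.Carrier → Flag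
  Φ · γ = record
    { ⟨_⟩     = λ y → A.from y ∈ ⟨ Φ ⟩
    ; isChain = record
      { resp       = λ x≈y → Flag.resp Φ (A⁻¹.cong x≈y)
      ; comparable = λ x∈ y∈ → Sum.map A⁻¹.cancel A⁻¹.cancel (Flag.comparable Φ x∈ y∈)
      }
    ; maximal = λ {D} D-chain Φγ⊆D {y} y∈D → Flag.maximal Φ
        {λ x → A.⟦_⟧ x ∈ D}
        (record
          { resp       = λ x≈y → IsChain.resp D-chain (A.cong x≈y)
          ; comparable = λ x∈ y∈ → Sum.map A.cancel A.cancel (IsChain.comparable D-chain x∈ y∈)
          })
        (λ {x} x∈Φ → Φγ⊆D (Flag.resp Φ (Eq.sym (A.from∘to x)) x∈Φ))
        (IsChain.resp D-chain (Eq.sym (A.to∘from y)) y∈D)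
    }
    where
    module A   = Automorphism γ
    module A⁻¹ = Automorphism (γ G.⁻¹)

  flagOrbits : Setoid (suc (c ⊔ ℓ₁ ⊔ ℓ₂)) (c ⊔ ℓ₁ ⊔ ℓ₂)
  flagOrbits = record
    { Carrier       = Flag
    ; _≈_           = λ Φ Ψ → ∃[ γ ] ⟨ Φ · γ ⟩ ≐ ⟨ Ψ ⟩
    ; isEquivalence = record
      { refl  = λ {_} → G.ε , id , id
      ; sym   = λ {Φ} {Ψ} → λ { (γ , ⊆₁ , ⊆₂) → γ G.⁻¹
              , (λ {x} x∈ → Flag.resp Φ (Automorphism.from∘to γ x) (⊆₂ x∈))
              , (λ {x} x∈ → ⊆₁ (Flag.resp Φ (Eq.sym (Automorphism.from∘to γ x)) x∈)) }
      ; trans = λ { (γ , ⊆₁ , ⊆₂) (δ , ⊆₃ , ⊆₄) → γ G.∙ δ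
              , (λ x∈ → ⊆₃ (⊆₁ x∈)) , (λ x∈ → ⊆₂ (⊆₄ x∈)) }
      }
    }

  module O = Setoid flagOrbits

  open Equivalence using () renaming (to to fwd⇔; from to bwd⇔)
  open Adjacent

  ≐⇒O : ∀ {Φ Ψ} → ⟨ Φ ⟩ ≐ ⟨ Ψ ⟩ → Φ O.≈ Ψ
  ≐⇒O Φ≐Ψ = G.ε , Φ≐Ψ

  adjacent-sym : ∀ {i Φ Ψ} → Adjacent i Φ Ψ → Adjacent i Ψ Φ
  adjacent-sym adj = record { fwd = bwd adj ; bwd = fwd adj }

  adjacent-respʳ : ∀ {i Φ Φ₁ Ψ} → ⟨ Φ ⟩ ≐ ⟨ Φ₁ ⟩ → Adjacent i Φ Ψ → Adjacent i Φ₁ Ψ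
  adjacent-respʳ (⊆₁ , ⊆₂) adj = record
    { fwd = λ x∈ → fwd adj (⊆₂ x∈)
    ; bwd = λ x∈ → mk⇔ (λ y∈ → fwd⇔ (bwd adj x∈) (⊆₂ y∈)) (λ ne → ⊆₁ (bwd⇔ (bwd adj x∈) ne))
    }

  adjacent-· : ∀ {i Φ Ψ} γ → Adjacent i Φ Ψ → Adjacent i (Φ · γ) (Ψ · γ)
  adjacent-· {i} {Φ} {Ψ} γ adj = record
    { fwd = λ {x} x∈ → subst⇔ (rank-from Φ x x∈) (fwd adj x∈)
    ; bwd = λ {x} x∈ → subst⇔ (rank-from Ψ x x∈) (bwd adj x∈)
    }
    where
    rank-from : ∀ Θ x → Automorphism.from γ x ∈ ⟨ Θ ⟩ → rank (Automorphism.from γ x) ≡ rank x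
    rank-from Θ x x∈ = ≡.trans (≡.sym (rank-aut γ Θ x∈)) (rank-cong (Automorphism.to∘from γ x))

    subst⇔ : ∀ {a} {A : Set a} {r s} → r ≡ s → A ⇔ r ≢ properRank i → A ⇔ s ≢ properRank i
    subst⇔ ≡.refl eqv = eqv

  ^-adjacent : ∀ Φ i → Adjacent i Φ (Φ ^ i)
  ^-adjacent Φ i = proj₁ (proj₂ (diamond Φ i))

  ^-unique : ∀ Φ i {Θ} → Adjacent i Φ Θ → ⟨ Θ ⟩ ≐ ⟨ Φ ^ i ⟩
  ^-unique Φ i = proj₂ (proj₂ (diamond Φ i))

  ^-cong : ∀ {Φ Ψ} i → Φ O.≈ Ψ → Φ ^ i O.≈ Ψ ^ i
  ^-cong {Φ} {Ψ} i (γ , Φγ≐Ψ) = γ , ^-unique Ψ i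
    (adjacent-respʳ Φγ≐Ψ (adjacent-· γ (^-adjacent Φ i)))

  ^-involutive : ∀ Φ i → Φ ^ i ^ i O.≈ Φ
  ^-involutive Φ i = O.sym {Φ} {Φ ^ i ^ i}
    (≐⇒O {Φ} {Φ ^ i ^ i} (^-unique (Φ ^ i) i (adjacent-sym (^-adjacent Φ i))))

  -- The dart (Φ , i) runs from the orbit of Φ to the orbit of Φ ^ i.

  𝒯 : ColouredGraph n (suc (c ⊔ ℓ₁ ⊔ ℓ₂)) (c ⊔ ℓ₁ ⊔ ℓ₂) (suc (c ⊔ ℓ₁ ⊔ ℓ₂)) (c ⊔ ℓ₁ ⊔ ℓ₂)
  𝒯 = record
    { vertices    = flagOrbits
    ; darts       = ×-setoid flagOrbits (≡.setoid (Fin n))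
    ; init        = proj₁
    ; term        = λ { (Φ , i) → Φ ^ i }
    ; inv         = λ { (Φ , i) → Φ ^ i , i }
    ; colour      = proj₂
    ; init-cong   = proj₁
    ; term-cong   = λ { {_ , i} (Φ≈Ψ , ≡.refl) → ^-cong i Φ≈Ψ }
    ; inv-cong    = λ { {_ , i} (Φ≈Ψ , ≡.refl) → ^-cong i Φ≈Ψ , ≡.refl }
    ; colour-cong = proj₂
    ; inv-inv     = λ { (Φ , i) → ^-involutive Φ i , ≡.refl }
    ; init-inv    = λ { (Φ , i) → O.refl {Φ ^ i} }
    ; term-inv    = λ { (Φ , i) → ^-involutive Φ i }
    ; colour-inv  = λ _ → ≡.refl
    ; no-loops    = λ { (Φ , i) Φ≈Φⁱ → O.sym {Φ} {Φ ^ i} Φ≈Φⁱ , ≡.refl }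
    ; unique-dart = λ Φ i → (Φ , i) , O.refl {Φ} , ≡.refl , λ Ψ≈Φ j≡i → Ψ≈Φ , j≡i
    }

{-# OPTIONS --safe #-}

-- Choose a base flag B x in every flag orbit x and let the voltage of a dart
-- of colour i from x to y be the unique automorphism taking B y to the
-- i-adjacent flag of B x.  The subgroup of closed voltages at x avoiding
-- colour i is then, by strong flag connectedness, the stabiliser of the
-- i-face of B x, so a coset of it amounts to a face of 𝒫 in the orbit of that
-- i-face.  Translated by α_i^y, the coset of a face a becomes the set of
-- automorphisms taking the i-face of B y to a; two translated cosets
-- therefore intersect exactly when the two faces lie in a common flag.

module Submission where

open import Defs
open import Axiom.ExcludedMiddle using (ExcludedMiddle)
open import Data.Nat.Base using (ℕ; _≥_)
open import Data.Product.Base using (Σ-syntax)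

open import Level using (_⊔_; Lift; lift)
open import Data.Fin.Base as Fin using (Fin)
import Data.Fin.Properties as Fin
open import Data.Fin.Relation.Unary.Top using (view; ‵fromℕ; ‵inject₁)
open import Data.List.Base using (List; []; _∷_; allFin)
open import Data.List.Membership.Propositional.Properties using (∈-allFin)
open import Data.List.Relation.Unary.All as All using (All; []; _∷_)
import Data.Nat.Base as ℕ
import Data.Nat.Properties as ℕ
open import Data.Product.Base using (∃-syntax; _×_; _,_; proj₁; proj₂)
open import Data.Sum.Base as Sum using (_⊎_; inj₁; inj₂; swap)
open import Function.Base using (_∘_; id)
open import Function.Bundles using (_⇔_; mk⇔; Equivalence; module Bijection)
open import Relation.Binary.PropositionalEquality as ≡ using (_≡_; _≢_)
open import Relation.Binary.Construct.Add.Extrema.Equality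
  using (⊥±≈⊥±; ⊤±≈⊤±) renaming ([_] to ≈[_])
open import Relation.Binary.Construct.Add.Extrema.NonStrict
  using (⊥±≤⊥±; ⊥±≤[_]; ⊥±≤⊤±; [_]≤⊤±; ⊤±≤⊤±) renaming ([_] to ≤[_])
open import Relation.Nullary using (yes; no; contradiction)
open import Relation.Nullary.Construct.Add.Extrema using (_±; ⊥±; ⊤±; [_])
open import Relation.Unary using (Pred; _∈_; _⊆_; _≐_)
open import Relation.Unary.Properties using (≐-sym; ≐-trans)

open Equivalence using () renaming (to to fwd⇔; from to bwd⇔)
open Automorphism using (⟦_⟧)

-- Colours as proper ranks.

properRank-mono : ∀ {n} {i j : Fin n} → i Fin.< j → properRank i Fin.< properRank j
properRank-mono {_} {i} {j} i<j = ℕ.s≤s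
  (≡.subst₂ ℕ._<_ (≡.sym (Fin.toℕ-inject₁ i)) (≡.sym (Fin.toℕ-inject₁ j)) i<j)

properRank-cancel : ∀ {n} {i j : Fin n} → properRank i Fin.< properRank j → i Fin.< j
properRank-cancel {_} {i} {j} (ℕ.s≤s i<j) =
  ≡.subst₂ ℕ._<_ (Fin.toℕ-inject₁ i) (Fin.toℕ-inject₁ j) i<j

properRank-injective : ∀ {n} {i j : Fin n} → properRank i ≡ properRank j → i ≡ j
properRank-injective = Fin.inject₁-injective ∘ Fin.suc-injective

properRank<max : ∀ {n} (i : Fin n) → properRank i Fin.< Fin.fromℕ (ℕ.suc n)
properRank<max {n} i = ℕ.s≤s (≡.subst₂ ℕ._<_
  (≡.sym (Fin.toℕ-inject₁ i)) (≡.sym (Fin.toℕ-fromℕ n)) (Fin.toℕ<n i))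

-- Flags and the free action of automorphisms on them.

module FlagProperties (em : ∀ {ℓ} → ExcludedMiddle ℓ)
                      {n c ℓ₁ ℓ₂} (𝒫 : Polytope n c ℓ₁ ℓ₂) where
  open Polytope 𝒫
  open SymmetryTypeGraph 𝒫

  ≤-sameRank : ∀ {x y} → x ≤ y → rank x ≡ rank y → x ≈ y
  ≤-sameRank {x} {y} x≤y eq with em {P = x ≈ y}
  ... | yes x≈y = x≈y
  ... | no  x≉y = contradiction (rank-mono (x≤y , x≉y)) (Fin.<-irrefl eq)

  chain-sameRank : ∀ {C x y} → IsChain C → x ∈ C → y ∈ C → rank x ≡ rank y → x ≈ y
  chain-sameRank ch x∈ y∈ eq with IsChain.comparable ch x∈ y∈
  ... | inj₁ x≤y = ≤-sameRank x≤y eq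
  ... | inj₂ y≤x = Eq.sym (≤-sameRank y≤x (≡.sym eq))

  rank-mono-≤ : ∀ {x y} → x ≤ y → rank x Fin.≤ rank y
  rank-mono-≤ {x} {y} x≤y with em {P = x ≈ y}
  ... | yes x≈y = ℕ.≤-reflexive (≡.cong Fin.toℕ (rank-cong x≈y))
  ... | no  x≉y = ℕ.<⇒≤ (rank-mono (x≤y , x≉y))

  -- Chains extend to flags without Zorn's lemma: go through the finitely many
  -- ranks, adding an element of that rank whenever one fits.

  Saturated : Pred Carrier (c ⊔ ℓ₁ ⊔ ℓ₂) → Fin (2 ℕ.+ n) → Set _
  Saturated C r = ∀ {D} → IsChain D → C ⊆ D → ∀ {y} → y ∈ D → rank y ≡ r → y ∈ C

  insert : Carrier → Pred Carrier (c ⊔ ℓ₁ ⊔ ℓ₂) → Pred Carrier (c ⊔ ℓ₁ ⊔ ℓ₂)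
  insert x C z = z ∈ C ⊎ Lift (c ⊔ ℓ₁ ⊔ ℓ₂) (z ≈ x)

  insert-isChain : ∀ {x C} → IsChain C → (∀ {z} → z ∈ C → x ≤ z ⊎ z ≤ x) →
                   IsChain (insert x C)
  insert-isChain {x} {C} ch cmp = record
    { resp = λ
      { y≈z (inj₁ y∈)         → inj₁ (IsChain.resp ch y≈z y∈)
      ; y≈z (inj₂ (lift y≈x)) → inj₂ (lift (Eq.trans (Eq.sym y≈z) y≈x)) }
    ; comparable = λ
      { (inj₁ y∈)         (inj₁ z∈)         → IsChain.comparable ch y∈ z∈
      ; (inj₁ y∈)         (inj₂ (lift z≈x)) → swap (with-x z≈x y∈)
      ; (inj₂ (lift y≈x)) (inj₁ z∈)         → with-x y≈x z∈
      ; (inj₂ (lift y≈x)) (inj₂ (lift z≈x)) → inj₁ (reflexive (Eq.trans y≈x (Eq.sym z≈x))) }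
    }
    where
    with-x : ∀ {y z} → y ≈ x → z ∈ C → y ≤ z ⊎ z ≤ y
    with-x y≈x z∈ = Sum.map (≤-respˡ-≈ (Eq.sym y≈x)) (≤-respʳ-≈ (Eq.sym y≈x)) (cmp z∈)

  -- If some element of rank `r` is comparable with all of `C`, inserting it saturates the chain,
  -- since elements of equal rank in a chain coincide. If there is none, no chain above `C` has an
  -- element of rank `r`, so `C` is saturated vacuously.
  saturate-at : ∀ {C} → IsChain C → ∀ r →
                ∃[ C′ ] IsChain C′ × C ⊆ C′ × Saturated C′ r
  saturate-at {C} ch r
    with em {P = ∃[ x ] rank x ≡ r × (∀ {z} → z ∈ C → x ≤ z ⊎ z ≤ x)}
  ... | yes (x , rx≡r , cmp) =
    insert x C , insert-isChain ch cmp , inj₁ , λ D-chain C′⊆D y∈D ry≡r →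
      inj₂ (lift (chain-sameRank D-chain y∈D (C′⊆D (inj₂ (lift Eq.refl)))
        (≡.trans ry≡r (≡.sym rx≡r))))
  ... | no none =
    C , ch , id , λ D-chain C⊆D y∈D ry≡r → contradiction
      (_ , ry≡r , λ {_} z∈ → IsChain.comparable D-chain y∈D (C⊆D z∈)) none

  saturate : ∀ {C} → IsChain C → (rs : List (Fin (2 ℕ.+ n))) →
             ∃[ C′ ] IsChain C′ × C ⊆ C′ × All (Saturated C′) rs
  saturate {C} ch [] = C , ch , id , []
  saturate ch (r ∷ rs) with saturate-at ch r
  ... | C₁ , ch₁ , C⊆C₁ , sat₁ with saturate ch₁ rs
  ...   | C₂ , ch₂ , C₁⊆C₂ , sat₂ =
    C₂ , ch₂ , C₁⊆C₂ ∘ C⊆C₁ ,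
    -- Saturation at `r` survives later insertions, since every chain containing `C₂` contains `C₁`.
    (λ D-chain C₂⊆D y∈D eq → C₁⊆C₂ (sat₁ D-chain (C₂⊆D ∘ C₁⊆C₂) y∈D eq)) ∷ sat₂

  -- A chain saturated at every rank is maximal, because any element of a larger chain has one of
  -- these ranks.
  extendToFlag : ∀ {C} → IsChain C → Σ[ Φ ∈ Flag ] C ⊆ ⟨ Φ ⟩
  extendToFlag ch with saturate ch (allFin (2 ℕ.+ n))
  ... | C′ , ch′ , C⊆C′ , sat = record
    { ⟨_⟩     = C′
    ; isChain = ch′
    ; maximal = λ D-chain C′⊆D {y} y∈D →
        All.lookup sat (∈-allFin (rank y)) D-chain C′⊆D y∈D ≡.refl
    } , C⊆C′

  flagThrough₂ : ∀ {x y} → x ≤ y → Σ[ Φ ∈ Flag ] x ∈ ⟨ Φ ⟩ × y ∈ ⟨ Φ ⟩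
  flagThrough₂ {x} {y} x≤y =
    let Φ , C⊆Φ = extendToFlag ch in
    Φ , C⊆Φ (inj₁ (lift Eq.refl)) , C⊆Φ (inj₂ (lift Eq.refl))
    where
    ch : IsChain (insert y (λ z → Lift (c ⊔ ℓ₁ ⊔ ℓ₂) (z ≈ x)))
    ch = insert-isChain
      (record
        { resp       = λ { y≈z (lift y≈x) → lift (Eq.trans (Eq.sym y≈z) y≈x) }
        ; comparable = λ { (lift y≈x) (lift z≈x) →
            inj₁ (reflexive (Eq.trans y≈x (Eq.sym z≈x))) }
        })
      (λ { (lift z≈x) → inj₂ (≤-respˡ-≈ (Eq.sym z≈x) x≤y) })

  flagThrough : ∀ x → Σ[ Φ ∈ Flag ] x ∈ ⟨ Φ ⟩
  flagThrough x = let Φ , x∈Φ , _ = flagThrough₂ (refl {x}) in Φ , x∈Φ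

  rank-⟦⟧ : ∀ (γ : G.Carrier) x → rank (⟦ γ ⟧ x) ≡ rank x
  rank-⟦⟧ γ x = let Φ , x∈Φ = flagThrough x in rank-aut γ Φ x∈Φ

  private
    elementOfRank : ∀ Φ r → ∃[ k ] rank (RankUnique.e Φ k) ≡ r
    elementOfRank Φ = RankUnique.r∘e-surjective Φ
      (record { r-cong = rank-cong ; r-mono = rank-mono })

  infixl 9 _at_

  abstract
    -- Kept opaque, since `at-∈` and `at-rank` already determine the element up to `≈`.
    _at_ : Flag → Fin (2 ℕ.+ n) → Carrier
    Φ at r = RankUnique.e Φ (proj₁ (elementOfRank Φ r))

    at-∈ : ∀ Φ r → Φ at r ∈ ⟨ Φ ⟩
    at-∈ Φ r = proj₂ (Bijection.to (flagSize Φ) (proj₁ (elementOfRank Φ r)))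

    at-rank : ∀ Φ r → rank (Φ at r) ≡ r
    at-rank Φ r = proj₂ (elementOfRank Φ r)

  at-unique : ∀ Φ {r x} → x ∈ ⟨ Φ ⟩ → rank x ≡ r → x ≈ Φ at r
  at-unique Φ {r} x∈ eq =
    chain-sameRank (Flag.isChain Φ) x∈ (at-∈ Φ r) (≡.trans eq (≡.sym (at-rank Φ r)))

  ∈-· : ∀ Φ γ {x} → x ∈ ⟨ Φ ⟩ → ⟦ γ ⟧ x ∈ ⟨ Φ · γ ⟩
  ∈-· Φ γ x∈ = Flag.resp Φ (Eq.sym (Automorphism.from∘to γ _)) x∈

  at-· : ∀ Φ γ r → ⟦ γ ⟧ (Φ at r) ∈ ⟨ Φ · γ ⟩
  at-· Φ γ r = ∈-· Φ γ (at-∈ Φ r)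

  ·-at : ∀ Φ γ Ψ r → ⟨ Φ · γ ⟩ ≐ ⟨ Ψ ⟩ → ⟦ γ ⟧ (Φ at r) ≈ Ψ at r
  ·-at Φ γ Ψ r (⊆Ψ , _) =
    at-unique Ψ (⊆Ψ (at-· Φ γ r)) (≡.trans (rank-⟦⟧ γ _) (at-rank Φ r))

  ^-at : ∀ Φ {i j} → i ≢ j → (Φ ^ i) at properRank j ≈ Φ at properRank j
  ^-at Φ {i} {j} i≢j = Eq.sym (at-unique (Φ ^ i)
    (bwd⇔ (Adjacent.fwd (^-adjacent Φ i) (at-∈ Φ _))
      (λ eq → i≢j (properRank-injective (≡.trans (≡.sym eq) (at-rank Φ _)))))
    (at-rank Φ _))

  -- This makes a sequence of flags through a common face of rank `i` project to a path avoiding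
  -- colour `i`.
  adjacent-colour : ∀ {Φ Ψ i j x} → Adjacent j Φ Ψ → x ∈ ⟨ Φ ⟩ → x ∈ ⟨ Ψ ⟩ →
                    rank x ≡ properRank i → j ≢ i
  adjacent-colour adj x∈Φ x∈Ψ eq ≡.refl = fwd⇔ (Adjacent.fwd adj x∈Φ) x∈Ψ eq

  adjacent-unique : ∀ {Φ Φ′ Ψ Ψ′ i} → ⟨ Φ ⟩ ≐ ⟨ Φ′ ⟩ → Adjacent i Φ Ψ →
                    Adjacent i Φ′ Ψ′ → ⟨ Ψ ⟩ ≐ ⟨ Ψ′ ⟩
  adjacent-unique {Φ} {Φ′} {i = i} Φ≐Φ′ adj adj′ = ≐-trans
    (^-unique Φ′ i (adjacent-respʳ {Φ = Φ} {Φ₁ = Φ′} Φ≐Φ′ adj)) (≐-sym (^-unique Φ′ i adj′))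

  ·-cong : ∀ Φ Ψ γ → ⟨ Φ ⟩ ≐ ⟨ Ψ ⟩ → ⟨ Φ · γ ⟩ ≐ ⟨ Ψ · γ ⟩
  ·-cong Φ Ψ γ (⊆₁ , ⊆₂) = (λ x∈ → ⊆₁ x∈) , (λ x∈ → ⊆₂ x∈)

  joined-start : ∀ {S Φ Ψ} → Joined S Φ Ψ → S ⊆ ⟨ Φ ⟩
  joined-start (stop S⊆Φ _)     = S⊆Φ
  joined-start (step _ S⊆Φ _ _) = S⊆Φ

  -- Automorphisms preserve adjacency and adjacent flags are unique, so agreement on one flag
  -- spreads along the sequence.
  agree-joined : ∀ {S Φ Ψ} γ δ → Joined S Φ Ψ →
                 ⟨ Φ · γ ⟩ ≐ ⟨ Φ · δ ⟩ → ⟨ Ψ · γ ⟩ ≐ ⟨ Ψ · δ ⟩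
  agree-joined {_} {Φ} {Ψ} γ δ (stop _ Φ≐Ψ) eq =
    ≐-trans (≐-sym (·-cong Φ Ψ γ Φ≐Ψ)) (≐-trans eq (·-cong Φ Ψ δ Φ≐Ψ))
  agree-joined {_} {Φ} γ δ (step {Θ = Θ} i _ adj js) eq = agree-joined γ δ js
    (adjacent-unique {Φ · γ} {Φ · δ} {Θ · γ} {Θ · δ} eq
      (adjacent-· {Φ = Φ} {Ψ = Θ} γ adj) (adjacent-· {Φ = Φ} {Ψ = Θ} δ adj))

  -- Each `x` lies in a flag joined to `Φ`. Agreement spreads to that flag, so both images of `x`
  -- lie in one chain and have the same rank.
  ·-free : ∀ Φ γ δ → ⟨ Φ · γ ⟩ ≐ ⟨ Φ · δ ⟩ → γ G.≈ δ
  ·-free Φ γ δ eq x =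
    let Ψ , x∈Ψ = flagThrough x
        ⊆₁ , _  = agree-joined γ δ (connected Φ Ψ) eq
    in chain-sameRank (Flag.isChain (Ψ · δ)) (⊆₁ (∈-· Ψ γ x∈Ψ)) (∈-· Ψ δ x∈Ψ)
         (≡.trans (rank-⟦⟧ γ x) (≡.sym (rank-⟦⟧ δ x)))

-- Base flags, the voltage assignment and the voltages of paths.

module BaseFlags (em : ∀ {ℓ} → ExcludedMiddle ℓ) (ac : ∀ {a ℓ} → Choice a ℓ)
                 {n c ℓ₁ ℓ₂} (𝒫 : Polytope n c ℓ₁ ℓ₂) where
  open Polytope 𝒫
  open SymmetryTypeGraph 𝒫
  open FlagProperties em 𝒫
  open ColouredGraph 𝒯 using (Path; empty; cons; allBut)

  B : Flag → Flag
  B = proj₁ (ac flagOrbits)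

  B≈ : ∀ Φ → B Φ O.≈ Φ
  B≈ = proj₁ (proj₂ (ac flagOrbits))

  B-cong : ∀ {Φ Ψ} → Φ O.≈ Ψ → B Φ ≡ B Ψ
  B-cong = proj₂ (proj₂ (ac flagOrbits))

  -- Both flags lie in the orbit of `Φ ^ i`, as adjacency descends to orbits. The automorphism
  -- witnessing this becomes the voltage of the dart.
  baseShift : ∀ Φ i → B (Φ ^ i) O.≈ B Φ ^ i
  baseShift Φ i = O.trans {B (Φ ^ i)} {Φ ^ i} {B Φ ^ i} (B≈ (Φ ^ i))
    (^-cong {Φ} {B Φ} i (O.sym {B Φ} {Φ} (B≈ Φ)))

  dartVoltage : Flag × Fin n → G.Carrier
  dartVoltage (Φ , i) = proj₁ (baseShift Φ i)

  dartVoltage-spec : ∀ Φ i → ⟨ B (Φ ^ i) · dartVoltage (Φ , i) ⟩ ≐ ⟨ B Φ ^ i ⟩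
  dartVoltage-spec Φ i = proj₂ (baseShift Φ i)

  voltage : Voltage 𝒯 G
  voltage = record
    { ξ      = dartVoltage
    -- By freeness it suffices to compare the images of one base flag.
    ; ξ-cong = λ { {Φ , i} {Ψ , _} (Φ≈Ψ , ≡.refl) →
        ·-free (B (Φ ^ i)) (dartVoltage (Φ , i)) (dartVoltage (Ψ , i))
          (≐-trans (dartVoltage-spec Φ i) (≐-sym
            (≡.subst₂ (λ Θ Ω → ⟨ Θ · dartVoltage (Ψ , i) ⟩ ≐ ⟨ Ω ^ i ⟩)
              (≡.sym (B-cong (^-cong {Φ} {Ψ} i Φ≈Ψ))) (≡.sym (B-cong Φ≈Ψ))
              (dartVoltage-spec Ψ i)))) }
    ; ξ-inv  = λ { (Φ , i) → ξ-inv Φ i }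
    }
    where
    -- Applying `γ G.⁻¹` to the adjacency of `B Φ ^ i` and `B Φ` shows that `B Φ · (γ G.⁻¹)` is the
    -- flag `i`-adjacent to `B′`. The voltage of the reversed dart also takes `B Φ` there, and
    -- freeness concludes.
    ξ-inv : ∀ Φ i → dartVoltage (Φ ^ i , i) G.≈ dartVoltage (Φ , i) G.⁻¹
    ξ-inv Φ i = ·-free (B Φ) (dartVoltage (Φ ^ i , i)) (γ G.⁻¹)
      (≐-trans
        (≡.subst (λ Θ → ⟨ Θ · dartVoltage (Φ ^ i , i) ⟩ ≐ ⟨ B (Φ ^ i) ^ i ⟩)
          (B-cong (^-involutive Φ i)) (dartVoltage-spec (Φ ^ i) i))
        (≐-sym (^-unique (B (Φ ^ i)) i adj)))
      where
      γ : G.Carrier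
      γ = dartVoltage (Φ , i)

      B′ : Flag
      B′ = B (Φ ^ i)

      γγ⁻¹ : ⟨ B′ · γ · (γ G.⁻¹) ⟩ ≐ ⟨ B′ ⟩
      γγ⁻¹ = (λ x∈ → Flag.resp B′ (Automorphism.from∘to γ _) x∈)
           , (λ x∈ → Flag.resp B′ (Eq.sym (Automorphism.from∘to γ _)) x∈)

      adj : Adjacent i B′ (B Φ · (γ G.⁻¹))
      adj = adjacent-respʳ {Φ = B′ · γ · (γ G.⁻¹)} {Φ₁ = B′} {Ψ = B Φ · (γ G.⁻¹)} γγ⁻¹
        (adjacent-· {Φ = B′ · γ} {Ψ = B Φ} (γ G.⁻¹)
          (adjacent-respʳ {Φ = B Φ ^ i} {Φ₁ = B′ · γ} {Ψ = B Φ} (≐-sym (dartVoltage-spec Φ i))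
            (adjacent-sym (^-adjacent (B Φ) i))))

  open Voltage voltage public using (ξ*)

  baseFace : Fin n → Flag → Carrier
  baseFace i x = B x at properRank i

  baseFace-cong : ∀ i {x y} → x O.≈ y → baseFace i x ≡ baseFace i y
  baseFace-cong i x≈y = ≡.cong (_at properRank i) (B-cong x≈y)

  -- The voltage of a dart takes the base flag at its end to a flag adjacent to the base flag at its
  -- start; a colour other than `i` leaves the face of rank `i` unchanged. Voltages of closed paths
  -- thus stabilise the base face.
  ξ*-baseFace : ∀ {i x y} (p : Path (allBut i) x y) →
                baseFace i x ≈ ⟦ ξ* p ⟧ (baseFace i y)
  ξ*-baseFace {i} (empty x≈y) = Eq.reflexive (baseFace-cong i x≈y)
  ξ*-baseFace {i} {x} {y} (cons (Φ , j) j≢i x≈Φ p) =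
    Eq.trans (Eq.reflexive (baseFace-cong i x≈Φ))
    (Eq.trans (Eq.sym (^-at (B Φ) j≢i))
    (Eq.trans (Eq.sym (·-at (B (Φ ^ j)) γ (B Φ ^ j) (properRank i) (dartVoltage-spec Φ j)))
      (Automorphism.cong γ (ξ*-baseFace p))))
    where
    γ : G.Carrier
    γ = dartVoltage (Φ , j)

  baseFace≈at : ∀ i x γ Φ → ⟨ B x · γ ⟩ ≐ ⟨ Φ ⟩ → ⟦ γ ⟧ (baseFace i x) ≈ Φ at properRank i
  baseFace≈at i x γ Φ = ·-at (B x) γ Φ (properRank i)

  -- The path is the projection of the sequence to orbits. The second component is path lifting: the
  -- voltage of the path accounts for the passage from `Φ` to `Ψ`. Arbitrary representatives `x` and
  -- `y` are allowed because the recursion passes to `x ^ j`, which is only in the orbit of `Θ`.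
  joined⇒path : ∀ {S Φ Ψ i z} → z ∈ S → rank z ≡ properRank i → Joined S Φ Ψ →
    ∀ x y → x O.≈ Φ → y O.≈ Ψ →
    Σ[ p ∈ Path (allBut i) x y ]
      (∀ γ → ⟨ B x · γ ⟩ ≐ ⟨ Φ ⟩ → ⟨ B y · (ξ* p G.∙ γ) ⟩ ≐ ⟨ Ψ ⟩)
  joined⇒path {_} {Φ} {Ψ} z∈S rz (stop _ Φ≐Ψ) x y x≈Φ y≈Ψ =
    empty x≈y , λ γ Bxγ≐Φ → ≐-trans
      (≡.subst (λ Θ → ⟨ Θ · γ ⟩ ≐ ⟨ Φ ⟩) (B-cong x≈y) Bxγ≐Φ) Φ≐Ψ
    where
    x≈y : x O.≈ y
    x≈y = O.trans {x} {Φ} {y} x≈Φ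
      (O.trans {Φ} {Ψ} {y} (≐⇒O {Φ} {Ψ} Φ≐Ψ) (O.sym {y} {Ψ} y≈Ψ))
  joined⇒path {S} {Φ} {Ψ} {i} z∈S rz (step {Θ = Θ} j S⊆Φ adj js) x y x≈Φ y≈Ψ =
    let p , carries = joined⇒path z∈S rz js (x ^ j) y x^j≈Θ y≈Ψ in
    cons (x , j) (adjacent-colour {Φ} {Θ} adj (S⊆Φ z∈S) (joined-start js z∈S) rz)
      (O.refl {x}) p ,
    λ γ Bxγ≐Φ → carries (dartVoltage (x , j) G.∙ γ) (≐-trans
      (·-cong (B (x ^ j) · dartVoltage (x , j)) (B x ^ j) γ (dartVoltage-spec x j))
      (adjacent-unique {B x · γ} {Φ} {(B x ^ j) · γ} {Θ} Bxγ≐Φ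
        (adjacent-· {Φ = B x} {Ψ = B x ^ j} γ (^-adjacent (B x) j)) adj))
    where
    x^j≈Θ : x ^ j O.≈ Θ
    x^j≈Θ = O.trans {x ^ j} {Φ ^ j} {Θ} (^-cong {x} {Φ} j x≈Φ)
      (≐⇒O {Φ ^ j} {Θ} (≐-sym (^-unique Φ j adj)))

  -- The strong form of flag connectedness enters here: the connecting flags all contain the shared
  -- face. For `x` equal to `y` and trivial `γ`, every automorphism fixing the base face is the
  -- voltage of a closed path.
  sharedFace⇒path : ∀ i x y γ δ → ⟦ γ ⟧ (baseFace i x) ≈ ⟦ δ ⟧ (baseFace i y) →
                    Σ[ p ∈ Path (allBut i) x y ] δ G.≈ ξ* p G.∙ γ
  sharedFace⇒path i x y γ δ eq =
    let p , carries = joined⇒path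
          (at-· (B x) γ (properRank i) ,
           Flag.resp (B y · δ) (Eq.sym eq) (at-· (B y) δ (properRank i)))
          (≡.trans (rank-⟦⟧ γ _) (at-rank (B x) (properRank i)))
          (connected (B x · γ) (B y · δ)) x y (orbit x γ) (orbit y δ)
    in p , ·-free (B y) δ (ξ* p G.∙ γ) (≐-sym (carries γ (id , id)))
    where
    orbit : ∀ z η → z O.≈ B z · η
    orbit z η = O.trans {z} {B z} {B z · η} (O.sym {B z} {z} (B≈ z)) (η , id , id)

-- The isomorphism from the coset poset to the polytope.

module Isomorphism (em : ∀ {ℓ} → ExcludedMiddle ℓ) (ac : ∀ {a ℓ} → Choice a ℓ)
                   {n c ℓ₁ ℓ₂} (𝒫 : Polytope n c ℓ₁ ℓ₂)
                   (choice : BaseChoice (SymmetryTypeGraph.𝒯 𝒫)) where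
  open Polytope 𝒫
  open SymmetryTypeGraph 𝒫
  open FlagProperties em 𝒫
  open BaseFlags em ac 𝒫
  open ColouredGraph 𝒯 using (Path; empty; cons; allBut)
  open BaseChoice choice
  open CosetPoset 𝒯 G voltage choice
  open Face

  path-trans : ∀ {I x y z} → Path I x y → Path I y z → Path I x z
  path-trans {x = x} {y} {z} (empty x≈y) (empty y≈z) = empty (O.trans {x} {y} {z} x≈y y≈z)
  path-trans {x = x} {y} (empty x≈y) (cons e e∈I y≈e q) =
    cons e e∈I (O.trans {x} {y} {proj₁ e} x≈y y≈e) q
  path-trans (cons e e∈I x≈e p) q = cons e e∈I x≈e (path-trans p q)

  root : Face → Carrier
  root A = baseFace (index A) (base (index A) (component A))

  f : Face → Carrier
  f A = ⟦ rep A ⟧ (root A)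

  f-rank : ∀ A → rank (f A) ≡ properRank (index A)
  f-rank A = ≡.trans (rank-⟦⟧ (rep A) _) (at-rank (B (base (index A) (component A))) _)

  -- The subgroup of closed voltages is the stabiliser of `root A`, by `ξ*-baseFace` and
  -- `sharedFace⇒path`. A right coset of it is therefore determined by the image of the root.
  ∈coset : ∀ A δ → δ ∈ coset A ⇔ ⟦ δ ⟧ (root A) ≈ f A
  ∈coset A δ = mk⇔ to from
    where
    x : Flag
    x = base (index A) (component A)

    to : δ ∈ coset A → ⟦ δ ⟧ (root A) ≈ f A
    to (η , (p , η≈p) , δ≈ηγ) = Eq.trans (δ≈ηγ (root A))
      (Automorphism.cong (rep A) (Eq.trans (η≈p (root A)) (Eq.sym (ξ*-baseFace p))))

    from : ⟦ δ ⟧ (root A) ≈ f A → δ ∈ coset A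
    from eq =
      let p , δ≈pγ = sharedFace⇒path (index A) x x (rep A) δ (Eq.sym eq)
      in ξ* p , (p , G.refl {ξ* p}) , δ≈pγ

  root-W : ∀ A y → Path (allBut (index A)) (component A) y →
           root A ≈ ⟦ α (index A) y ⟧ (baseFace (index A) y)
  root-W A y q = Eq.trans
    (Eq.reflexive (baseFace-cong (index A) (base-cong (index A) q)))
    (ξ*-baseFace (W (index A) y))

  -- Translation by `α` replaces the root by the base face at `y`. Cosets of different colours can
  -- then be compared through the single flag `B y`.
  ∈α◃coset : ∀ A y → Path (allBut (index A)) (component A) y → ∀ δ →
             δ ∈ (α (index A) y ◃ coset A) ⇔ ⟦ δ ⟧ (baseFace (index A) y) ≈ f A
  ∈α◃coset A y q δ = mk⇔ to from
    where
    b : Carrier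
    b = baseFace (index A) y

    a a⁻¹δ : G.Carrier
    a    = α (index A) y
    a⁻¹δ = a G.⁻¹ G.∙ δ

    δ≈aa⁻¹δ : δ G.≈ a G.∙ a⁻¹δ
    δ≈aa⁻¹δ z = Automorphism.cong δ (Eq.sym (Automorphism.from∘to a z))

    to : δ ∈ (a ◃ coset A) → ⟦ δ ⟧ b ≈ f A
    to (η , η∈ , δ≈aη) = Eq.trans (δ≈aη b)
      (Eq.trans (Automorphism.cong η (Eq.sym (root-W A y q))) (fwd⇔ (∈coset A η) η∈))

    from : ⟦ δ ⟧ b ≈ f A → δ ∈ (a ◃ coset A)
    from eq = a⁻¹δ , bwd⇔ (∈coset A a⁻¹δ)
      (Eq.trans (Automorphism.cong a⁻¹δ (root-W A y q))
        (Eq.trans (Eq.sym (δ≈aa⁻¹δ b)) eq)) , δ≈aa⁻¹δ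

  f-cong : ∀ A A′ → A ≈F A′ → f A ≈ f A′
  f-cong A A′ (≡.refl , q , ⊆₁ , _) = Eq.trans
    (Automorphism.cong (rep A)
      (Eq.reflexive (baseFace-cong (index A) (base-cong (index A) q))))
    -- `rep A` lies in its own coset, hence in that of `A′`.
    (fwd⇔ (∈coset A′ (rep A)) (⊆₁ {rep A} (bwd⇔ (∈coset A (rep A)) Eq.refl)))

  coset⊆ : ∀ A A′ → root A ≡ root A′ → f A ≈ f A′ → coset A ⊆ coset A′
  coset⊆ A A′ r≡r′ eq {δ} δ∈ = bwd⇔ (∈coset A′ δ)
    (Eq.trans (Automorphism.cong δ (Eq.reflexive (≡.sym r≡r′)))
      (Eq.trans (fwd⇔ (∈coset A δ) δ∈) eq))

  f-injective-index : ∀ i y γ y′ γ′ → f (face i y γ) ≈ f (face i y′ γ′) →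
                      face i y γ ≈F face i y′ γ′
  f-injective-index i y γ y′ γ′ eq =
    ≡.refl , q ,
    (λ {δ} → coset⊆ A A′ roots eq {δ}) , (λ {δ} → coset⊆ A′ A (≡.sym roots) (Eq.sym eq) {δ})
    where
    A A′ : Face
    A  = face i y γ
    A′ = face i y′ γ′

    -- Equal images join the two base vertices without colour `i`, so the components agree.
    q : Path (allBut i) y y′
    q = path-trans (base-in i y) (path-trans
      (proj₁ (sharedFace⇒path i (base i y) (base i y′) γ γ′ eq)) (W i y′))

    roots : root A ≡ root A′
    roots = baseFace-cong i (base-cong i q)

  f-injective : ∀ A A′ → f A ≈ f A′ → A ≈F A′
  f-injective A A′ eq = go A A′ (properRank-injective
      (≡.trans (≡.sym (f-rank A)) (≡.trans (rank-cong eq) (f-rank A′)))) eq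
    where
    go : ∀ A A′ → index A ≡ index A′ → f A ≈ f A′ → A ≈F A′
    go (face i y γ) (face _ y′ γ′) ≡.refl = f-injective-index i y γ y′ γ′

  -- A common element `δ` of the translated cosets puts both images in the flag `B y · δ`. They are
  -- thus comparable, and the ranks decide the direction.
  f-mono-< : ∀ A A′ → A <F A′ → f A < f A′
  f-mono-< A A′ (i<j , y , q , q′ , δ , δ∈ , δ∈′) = lt
    (Flag.comparable (B y · δ) (mem A q δ∈) (mem A′ q′ δ∈′))
    where
    mem : ∀ A → Path (allBut (index A)) (component A) y →
          δ ∈ (α (index A) y ◃ coset A) → f A ∈ ⟨ B y · δ ⟩
    mem A q δ∈ = Flag.resp (B y · δ) (fwd⇔ (∈α◃coset A y q δ) δ∈) (at-· (B y) δ _)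

    ranks : rank (f A) Fin.< rank (f A′)
    ranks = ≡.subst₂ Fin._<_ (≡.sym (f-rank A)) (≡.sym (f-rank A′)) (properRank-mono i<j)

    lt : f A ≤ f A′ ⊎ f A′ ≤ f A → f A < f A′
    lt (inj₁ ≤′) = ≤′ , λ eq → Fin.<-irrefl (rank-cong eq) ranks
    lt (inj₂ ≥′) = contradiction ranks (ℕ.≤⇒≯ (rank-mono-≤ ≥′))

  baseFlag-∋ : ∀ i Φ {x} → x ∈ ⟨ Φ ⟩ → rank x ≡ properRank i →
               ⟦ proj₁ (B≈ Φ) ⟧ (baseFace i Φ) ≈ x
  baseFlag-∋ i Φ x∈Φ rx = Eq.trans (baseFace≈at i Φ (proj₁ (B≈ Φ)) Φ (proj₂ (B≈ Φ)))
    (Eq.sym (at-unique Φ x∈Φ rx))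

  -- A flag `Φ` through both images serves as the common vertex, and the automorphism taking `B Φ`
  -- to `Φ` lies in both translated cosets.
  f-cancel-< : ∀ A A′ → f A < f A′ → A <F A′
  f-cancel-< A A′ fA<fA′ =
    properRank-cancel (≡.subst₂ Fin._<_ (f-rank A) (f-rank A′) (rank-mono fA<fA′)) ,
    Φ , q A fA∈ , q A′ fA′∈ , proj₁ (B≈ Φ) , mem A fA∈ , mem A′ fA′∈
    where
    Φ,∈∈ = flagThrough₂ (proj₁ fA<fA′)

    Φ : Flag
    Φ = proj₁ Φ,∈∈

    fA∈ : f A ∈ ⟨ Φ ⟩
    fA∈ = proj₁ (proj₂ Φ,∈∈)

    fA′∈ : f A′ ∈ ⟨ Φ ⟩
    fA′∈ = proj₂ (proj₂ Φ,∈∈)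

    q : ∀ A → f A ∈ ⟨ Φ ⟩ → Path (allBut (index A)) (component A) Φ
    q A fA∈ = path-trans (base-in (index A) (component A))
      (proj₁ (sharedFace⇒path (index A) _ Φ (rep A) (proj₁ (B≈ Φ))
        (Eq.sym (baseFlag-∋ (index A) Φ fA∈ (f-rank A)))))

    mem : ∀ A → (fA∈ : f A ∈ ⟨ Φ ⟩) → proj₁ (B≈ Φ) ∈ (α (index A) Φ ◃ coset A)
    mem A fA∈ = bwd⇔ (∈α◃coset A Φ (q A fA∈) (proj₁ (B≈ Φ)))
      (baseFlag-∋ (index A) Φ fA∈ (f-rank A))

  f-mono : ∀ A A′ → A ≤F A′ → f A ≤ f A′
  f-mono A A′ (inj₁ A<A′) = proj₁ (f-mono-< A A′ A<A′)
  f-mono A A′ (inj₂ A≈A′) = reflexive (f-cong A A′ A≈A′)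

  f-cancel : ∀ A A′ → f A ≤ f A′ → A ≤F A′
  f-cancel A A′ fA≤fA′ with em {P = f A ≈ f A′}
  ... | yes fA≈fA′ = inj₂ (f-injective A A′ fA≈fA′)
  ... | no  fA≉fA′ = inj₁ (f-cancel-< A A′ (fA≤fA′ , fA≉fA′))

  f-surjective : ∀ i x → rank x ≡ properRank i → ∃[ A ] f A ≈ x
  f-surjective i x rx =
    let Φ , x∈Φ = flagThrough x
        a = α i Φ
        δ = proj₁ (B≈ Φ)
    -- The root is the image under `a` of the base face at `Φ`; undoing `a` and applying `δ` leads
    -- to `x`.
    in face i Φ (a G.⁻¹ G.∙ δ) ,
       Eq.trans (Automorphism.cong (a G.⁻¹ G.∙ δ) (ξ*-baseFace (W i Φ)))
       (Eq.trans (Automorphism.cong δ (Automorphism.from∘to a _)) (baseFlag-∋ i Φ x∈Φ rx))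

  -- Adjoining the least and greatest elements.

  0̂ 1̂ : Carrier
  0̂ = proj₁ least
  1̂ = proj₁ greatest

  -- Some element attains the smallest rank, and the least element lies below it.
  rank-0̂ : rank 0̂ ≡ Fin.zero
  rank-0̂ = let x , rx = rank-onto Fin.zero in
    Fin.toℕ-injective (ℕ.n≤0⇒n≡0
      (≡.subst (rank 0̂ Fin.≤_) rx (rank-mono-≤ (proj₂ least x))))

  rank-1̂ : rank 1̂ ≡ Fin.fromℕ (ℕ.suc n)
  rank-1̂ = let x , rx = rank-onto (Fin.fromℕ (ℕ.suc n)) in
    Fin.≤-antisym (Fin.≤fromℕ _)
      (≡.subst (Fin._≤ rank 1̂) rx (rank-mono-≤ (proj₂ greatest x)))

  f± : Face ± → Carrier
  f± ⊥±    = 0̂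
  f± ⊤±    = 1̂
  f± [ A ] = f A

  0<f : ∀ A → rank 0̂ Fin.< rank (f A)
  0<f A = ≡.subst₂ Fin._<_ (≡.sym rank-0̂) (≡.sym (f-rank A)) (ℕ.s≤s ℕ.z≤n)

  f<1 : ∀ A → rank (f A) Fin.< rank 1̂
  f<1 A = ≡.subst₂ Fin._<_ (≡.sym (f-rank A)) (≡.sym rank-1̂) (properRank<max (index A))

  0<1 : rank 0̂ Fin.< rank 1̂
  0<1 = ≡.subst₂ Fin._<_ (≡.sym rank-0̂) (≡.sym rank-1̂) (ℕ.s≤s ℕ.z≤n)

  f±-cong : ∀ {A A′} → A ≈± A′ → f± A ≈ f± A′
  f±-cong ⊥±≈⊥± = Eq.refl
  f±-cong ⊤±≈⊤± = Eq.refl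
  f±-cong {[ A ]} {[ A′ ]} ≈[ A≈A′ ] = f-cong A A′ A≈A′

  f±-mono : ∀ {A A′} → A ≤± A′ → f± A ≤ f± A′
  f±-mono ⊥±≤⊥±    = refl
  f±-mono ⊥±≤[ A ] = proj₂ least (f A)
  f±-mono ⊥±≤⊤±    = proj₂ least 1̂
  f±-mono [ A ]≤⊤± = proj₂ greatest (f A)
  f±-mono ⊤±≤⊤±    = refl
  f±-mono {[ A ]} {[ A′ ]} ≤[ A≤A′ ] = f-mono A A′ A≤A′

  f±-cancel : ∀ {A A′} → f± A ≤ f± A′ → A ≤± A′
  f±-cancel {⊥±}    {⊥±}     _  = ⊥±≤⊥±
  f±-cancel {⊥±}    {[ A ]}  _  = ⊥±≤[ A ]
  f±-cancel {⊥±}    {⊤±}     _  = ⊥±≤⊤±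
  f±-cancel {[ A ]} {⊤±}     _  = [ A ]≤⊤±
  f±-cancel {⊤±}    {⊤±}     _  = ⊤±≤⊤±
  f±-cancel {[ A ]} {[ A′ ]} le = ≤[ f-cancel A A′ le ]
  f±-cancel {[ A ]} {⊥±}     le = contradiction (0<f A) (ℕ.≤⇒≯ (rank-mono-≤ le))
  f±-cancel {⊤±}    {⊥±}     le = contradiction 0<1 (ℕ.≤⇒≯ (rank-mono-≤ le))
  f±-cancel {⊤±}    {[ A ]}  le = contradiction (f<1 A) (ℕ.≤⇒≯ (rank-mono-≤ le))

  f±-injective : ∀ {A A′} → f± A ≈ f± A′ → A ≈± A′
  f±-injective {⊥±}    {⊥±}     _  = ⊥±≈⊥±
  f±-injective {⊤±}    {⊤±}     _  = ⊤±≈⊤±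
  f±-injective {[ A ]} {[ A′ ]} eq = ≈[ f-injective A A′ eq ]
  f±-injective {⊥±}    {[ A ]}  eq = contradiction (0<f A) (Fin.<-irrefl (rank-cong eq))
  f±-injective {⊥±}    {⊤±}     eq = contradiction 0<1 (Fin.<-irrefl (rank-cong eq))
  f±-injective {[ A ]} {⊤±}     eq = contradiction (f<1 A) (Fin.<-irrefl (rank-cong eq))
  f±-injective {[ A ]} {⊥±}     eq =
    contradiction (0<f A) (Fin.<-irrefl (rank-cong (Eq.sym eq)))
  f±-injective {⊤±}    {⊥±}     eq = contradiction 0<1 (Fin.<-irrefl (rank-cong (Eq.sym eq)))
  f±-injective {⊤±}    {[ A ]}  eq =
    contradiction (f<1 A) (Fin.<-irrefl (rank-cong (Eq.sym eq)))

  f±-surjective : ∀ x → ∃[ A ] f± A ≈ x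
  f±-surjective x with rank x in rx
  ... | Fin.zero  = ⊥± , ≤-sameRank (proj₂ least x) (≡.trans rank-0̂ (≡.sym rx))
  -- A nonzero rank is either the top one or `Fin.suc` of some `inject₁ i`, which is `properRank i`.
  ... | Fin.suc k with view k
  ...   | ‵fromℕ     = ⊤± , Eq.sym (≤-sameRank (proj₂ greatest x) (≡.trans rx (≡.sym rank-1̂)))
  ...   | ‵inject₁ i = let A , fA≈x = f-surjective i x rx in [ A ] , fA≈x

  isomorphic : _IsIsomorphicTo_ poset
  isomorphic = f± , record
    { isOrderMonomorphism = record
      { isOrderHomomorphism = record { cong = f±-cong ; mono = f±-mono }
      ; injective           = f±-injective
      ; cancel              = f±-cancel
      }
    ; surjective = λ x → let A , fA≈x = f±-surjective x in
        A , λ A′≈A → Eq.trans (f±-cong A′≈A) fA≈x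
    }

mainTheorem1 : (∀ {ℓ} → ExcludedMiddle ℓ) → (∀ {a ℓ} → Choice a ℓ) →
    ∀ {c ℓ₁ ℓ₂} (n : ℕ) → n ≥ 1 → (𝒫 : Polytope n c ℓ₁ ℓ₂) →
    let P = Polytope.poset 𝒫
        X = SymmetryTypeGraph.𝒯 𝒫
    in
    Σ[ ξ ∈ Voltage X (Γ P) ] ∀ (choice : BaseChoice X) →
      CosetPoset._IsIsomorphicTo_ X (Γ P) ξ choice P
mainTheorem1 em ac _ _ 𝒫 = BaseFlags.voltage em ac 𝒫 , Isomorphism.isomorphic em ac 𝒫
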